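{- Let $n\ge1$. The mapping $\vartheta:\mathcal B_n\to\mathcal B_n$ is an involution that preserves the right chain sequences and switches the statistics $\mathsf{spi}$ and $\mathsf{rspi}$; that is, for all $B\in\mathcal B_n$, $\vartheta(\vartheta(B))=B$, the right chain sequences of $B$ and $\vartheta(B)$ coincide, $\mathsf{spi}(\vartheta(B))=\mathsf{rspi}(B)$ and $\mathsf{rspi}(\vartheta(B))=\mathsf{spi}(B)$.
   Context: A binary tree is a rooted tree in which each node has at most one left child and at most one right child; $\mathcal B_n$ is the set of binary trees with $n$ nodes. **Orders.** The preorder visits, recursively, the parent, then its left subtree, then its right subtree. The reverse preorder visits, recursively, the right subtree, then the left subtree, then the parent (so it is the reversal of the preorder). **Statistics.** $\mathsf{spi}(B)$ is the smallest $i$ such that the $(i+1)$-th node of $B$ under the preorder is a right child. $\mathsf{rspi}(B)$ is the smallest $i$ such that the $(i+1)$-th node of $B$ under the reverse preorder has a right child. By convention, if $B$ is the binary tree with $n$ nodes having only left edges, $\mathsf{spi}(B)=\mathsf{rspi}(B)=n$. **Right chains.** A right chain of $B$ is a maximal path composed only of right edges (single nodes with no incident right edge count as right chains of length $0$); its length is its number of right edges. The right chain sequence of $B$ is the multiset of the lengths of all right chains of $B$. **The map $\vartheta$.** Let $B\in\mathcal B_n$ and let $v_i$ be the $i$-th node of $B$ under the preorder. Then $\vartheta(B)$ is the binary tree on the nodes $v_1,\dots,v_n$ with root $v_n$ such that, for $i$ from $n-1$ down to $1$: if $v_i$ has right child $v_\ell$ ($\ell>i$) in $B$, then $v_i$ is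 the right child of $v_\ell$ in $\vartheta(B)$; otherwise ($v_i$ has no right child in $B$), $v_i$ is the left child of $v_{i+1}$ in $\vartheta(B)$. Trees in $\mathcal B_n$ are considered as unlabeled; the names $v_i$ only serve the construction. -}

module Defs where

open import Data.Bool using (Bool; true; false; _∨_; not; if_then_else_)
open import Data.Fin using (toℕ)
open import Data.List
  using (List; []; _∷_; _++_; [_]; map; length; findIndexᵇ; filterᵇ)
open import Data.Maybe as Maybe using (Maybe; just; nothing; maybe; is-just)
open import Data.Nat using (ℕ; _∸_)
open import Data.Tree.Binary using (Tree; leaf; node; mapₙ; #nodes)
open import Data.Unit using (⊤; tt)
open import Function using (_∘_; const)
open import Relation.Binary.Definitions using (DecidableEquality)
open import Relation.Binary.PropositionalEquality using (refl; cong)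
open import Relation.Nullary using (does; yes; no)
open import Relation.Nullary.Decidable using (map′)

-- The nodes of a binary tree are the `node` constructors; `leaf` marks an
-- absent child.
BinaryTree : Set
BinaryTree = Tree ⊤ ⊤

pattern ∅ = leaf tt

data Node : BinaryTree → Set where
  root  : ∀ {l x r} → Node (node l x r)
  left  : ∀ {l x r} → Node l → Node (node l x r)
  right : ∀ {l x r} → Node r → Node (node l x r)

_≟_ : ∀ {B} → DecidableEquality (Node B)
root    ≟ root    = yes refl
root    ≟ left _  = no λ ()
root    ≟ right _ = no λ ()
left _  ≟ root    = no λ ()
left u  ≟ left v  = map′ (cong left) (λ { refl → refl }) (u ≟ v)
left _  ≟ right _ = no λ ()
right _ ≟ root    = no λ ()
right _ ≟ left _  = no λ ()
right u ≟ right v = map′ (cong right) (λ { refl → refl }) (u ≟ v)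

preorder : (B : BinaryTree) → List (Node B)
preorder ∅            = []
preorder (node l _ r) = root ∷ map left (preorder l) ++ map right (preorder r)

reversePreorder : (B : BinaryTree) → List (Node B)
reversePreorder ∅            = []
reversePreorder (node l _ r) =
  map right (reversePreorder r) ++ map left (reversePreorder l) ++ [ root ]

rootOf : (B : BinaryTree) → Maybe (Node B)
rootOf ∅            = nothing
rootOf (node _ _ _) = just root

rightChild : ∀ {B} → Node B → Maybe (Node B)
rightChild {node _ _ r} root      = Maybe.map right (rootOf r)
rightChild              (left v)  = Maybe.map left (rightChild v)
rightChild              (right v) = Maybe.map right (rightChild v)

hasRightChild : ∀ {B} → Node B → Bool
hasRightChild v = is-just (rightChild v)

isRoot : ∀ {B} → Node B → Bool
isRoot root      = true
isRoot (left _)  = false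
isRoot (right _) = false

isRightChild : ∀ {B} → Node B → Bool
isRightChild root      = false
isRightChild (left v)  = isRightChild v
isRightChild (right v) = isRoot v ∨ isRightChild v

-- `findIndexᵇ` counts from 0, so it returns the smallest i such that the
-- (i+1)-th entry satisfies the predicate.  It fails exactly when the tree has
-- no right edge, where the conventional value is the number of nodes.

spi : BinaryTree → ℕ
spi B = maybe toℕ (#nodes B) (findIndexᵇ isRightChild (preorder B))

rspi : BinaryTree → ℕ
rspi B = maybe toℕ (#nodes B) (findIndexᵇ hasRightChild (reversePreorder B))

rightBranch : (B : BinaryTree) → List (Node B)
rightBranch ∅            = []
rightBranch (node _ _ r) = root ∷ map right (rightBranch r)

-- The path that starts at the given node and follows right edges for as long
-- as there are any.
rightPathFrom : ∀ {B} → Node B → List (Node B)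
rightPathFrom {B} root      = rightBranch B
rightPathFrom     (left v)  = map left (rightPathFrom v)
rightPathFrom     (right v) = map right (rightPathFrom v)

-- A path of right edges is maximal when its top node is not a right child and
-- its bottom node has no right child; there is one such path for each node
-- that is not a right child.
rightChains : (B : BinaryTree) → List (List (Node B))
rightChains B = map rightPathFrom (filterᵇ (not ∘ isRightChild) (preorder B))

-- The length of a path is its number of edges, one less than its number of
-- nodes.  The list represents a multiset, to be compared up to permutation.
rightChainSequence : BinaryTree → List ℕ
rightChainSequence B = map (λ p → length p ∸ 1) (rightChains B)

module _ {B : BinaryTree} where

  LabelledTree : Set
  LabelledTree = Tree (Node B) ⊤

  singleton : Node B → LabelledTree
  singleton v = node ∅ v ∅

  -- `attachLeft v w t` makes v the left child of the node labelled w in t, and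
  -- `attachRight v w t` makes it the right child.

  attachLeft : Node B → Node B → LabelledTree → LabelledTree
  attachLeft v w ∅            = ∅
  attachLeft v w (node l x r) =
    if does (x ≟ w)
    then node (singleton v) x r
    else node (attachLeft v w l) x (attachLeft v w r)

  attachRight : Node B → Node B → LabelledTree → LabelledTree
  attachRight v w ∅            = ∅
  attachRight v w (node l x r) =
    if does (x ≟ w)
    then node l x (singleton v)
    else node (attachRight v w l) x (attachRight v w r)

  -- The step for v = v_i, where w = v_{i+1}.
  attach : Node B → Node B → LabelledTree → LabelledTree
  attach v w t = maybe (λ u → attachRight v u t) (attachLeft v w t) (rightChild v)

  -- Applied to v_i, …, v_n, this makes v_n the root and then attaches
  -- v_{n-1}, …, v_i in this order.  When it is applied to the preorder, no
  -- attachment fails or overwrites a child: the node v is attached to is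
  -- already present, only v_i uses the left slot of v_{i+1}, and a node is the
  -- right child of at most one node of B.
  build : List (Node B) → LabelledTree
  build []           = ∅
  build (v ∷ [])     = singleton v
  build (v ∷ w ∷ vs) = attach v w (build (w ∷ vs))

ϑ : BinaryTree → BinaryTree
ϑ B = mapₙ (const tt) (build (preorder B))

{-# OPTIONS --safe #-}
module Submission where

-- Cutting off the left subtree of the bottom node of each right chain splits a
-- tree into a list of right chains, each of which carries a list of left
-- subtrees; ϑ reverses all these lists, at every level of nesting.  Write S ⇒ t
-- for the reversal of S onto an accumulator t, so that ϑ S = (S ⇒ node ∅ ∅).
-- Then ϑ (S ⇒ t) = (t ⇒ S), and t = node ∅ ∅ shows that ϑ is an involution.  The
-- i-th node of S in preorder is a right child if and only if the i-th node of ϑ S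
-- in reverse preorder has a right child, so ϑ turns spi into rspi, and rspi into
-- spi because it is an involution.

open import Defs
open import Data.Bool using (Bool; true; false; _∨_; not)
open import Data.Bool.Properties using (T?)
open import Data.Empty using (⊥-elim)
open import Data.Fin as Fin using (Fin; toℕ)
open import Data.List
  using (List; []; _∷_; _++_; [_]; map; length; reverse; findIndexᵇ; filterᵇ)
open import Data.List.Properties
  using ( map-++; map-∘; map-id; map-cong; length-map; length-++; length-reverse
        ; ++-assoc; ++-identityʳ; filter-++; reverse-++; reverse-map; unfold-reverse)
open import Data.List.Relation.Binary.Permutation.Propositional
  using (_↭_; prep; ↭-reflexive; module PermutationReasoning)
open import Data.List.Relation.Binary.Permutation.Propositional.Properties
  using (++⁺ˡ; ++⁺ʳ; shift; shifts)
open import Data.Maybe as Maybe using (Maybe; just; nothing; maybe; is-just)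
open import Data.Nat using (ℕ; suc; _+_; _∸_; _≤_)
open import Data.Nat.Properties using (+-suc; +-identityʳ)
open import Data.Product using (_×_; _,_)
open import Data.Tree.Binary using (Tree; node; mapₙ; #nodes)
open import Data.Unit using (⊤; tt)
open import Function using (_∘_; const; id)
open import Function.Definitions using (Injective)
open import Relation.Binary.PropositionalEquality
  using (_≡_; _≢_; _≗_; refl; sym; trans; cong; cong₂; module ≡-Reasoning)
open import Relation.Nullary using (yes; no)

-- Reversal of a tree onto an accumulator.

private
  variable
    A C D : Set

-- Node u of S becomes a node labelled f u, except that the root of S becomes the
-- root of t (the label of that root is left to the caller).
reverseOnto : (S : BinaryTree) → (Node S → A) → Tree A ⊤ → Tree A ⊤
reverseTree : (S : BinaryTree) → (Node S → A) → Tree A ⊤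

reverseOnto ∅ f t = t
-- The right child becomes the parent, with `t` as its right subtree. In preorder it follows the
-- last node of `l`, so the reversed `l` goes into its left slot.
reverseOnto (node l _ r@(node _ _ _)) f t =
  reverseOnto r (f ∘ right) (node (reverseTree l (f ∘ left)) (f (right root)) t)
reverseOnto (node ∅ _ ∅) f t = t
-- Without a right child, the node is the left child of its preorder successor, here the root of
-- `l`.
reverseOnto (node l@(node _ _ _) _ ∅) f t =
  reverseOnto l (f ∘ left) (node t (f (left root)) ∅)

reverseTree ∅              f = ∅
reverseTree S@(node _ _ _) f = reverseOnto S f (node ∅ (f root) ∅)

mapₙ-reverseOnto : ∀ (g : A → C) S f t →
  mapₙ g (reverseOnto S f t) ≡ reverseOnto S (g ∘ f) (mapₙ g t)
mapₙ-reverseTree : ∀ (g : A → C) S f →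
  mapₙ g (reverseTree S f) ≡ reverseTree S (g ∘ f)

mapₙ-reverseOnto g ∅ f t = refl
mapₙ-reverseOnto g (node l _ r@(node _ _ _)) f t =
  trans (mapₙ-reverseOnto g r (f ∘ right) _)
        (cong (λ l′ → reverseOnto r (g ∘ f ∘ right) (node l′ _ _))
              (mapₙ-reverseTree g l (f ∘ left)))
mapₙ-reverseOnto g (node ∅ _ ∅) f t = refl
mapₙ-reverseOnto g (node l@(node _ _ _) _ ∅) f t = mapₙ-reverseOnto g l (f ∘ left) _

mapₙ-reverseTree g ∅              f = refl
mapₙ-reverseTree g S@(node _ _ _) f = mapₙ-reverseOnto g S f _

-- Contexts that commute with attachment.

record ActsAt (w : A) (op : Tree A ⊤ → Tree A ⊤) : Set where
  field
    on-leaf : op ∅ ≡ ∅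
    on-node : ∀ {l x r} → x ≢ w → op (node l x r) ≡ node (op l) x (op r)

open ActsAt

-- The semantic way to say that w labels no node of the context c.
_∉_ : {A : Set} → A → (Tree A ⊤ → Tree A ⊤) → Set
w ∉ c = ∀ {op} → ActsAt w op → ∀ t → op (c t) ≡ c (op t)

∉-∘ : {c d : Tree A ⊤ → Tree A ⊤} {w : A} → w ∉ c → w ∉ d → w ∉ (c ∘ d)
∉-∘ {c = c} w∉c w∉d acts t = trans (w∉c acts _) (cong c (w∉d acts t))

-- w = f root is allowed: that label sits at the root of the argument t, not in
-- the context.
reverseOnto-∉ : ∀ {l r} (f : Node (node l tt r) → A) {w} →
  (∀ u → f u ≡ w → u ≡ root) → w ∉ reverseOnto (node l tt r) f
reverseTree-∉ : ∀ S (f : Node S → A) {w op} →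
  (∀ u → f u ≢ w) → ActsAt w op → op (reverseTree S f) ≡ reverseTree S f

reverseOnto-∉ {l = l} {r = r@(node _ _ _)} f {w} fresh {op} acts t = begin
  op (reverseOnto r (f ∘ right) (node l′ x t))
    ≡⟨ reverseOnto-∉ (f ∘ right) (λ u eq → ⊥-elim (fresh-right u eq)) acts _ ⟩
  reverseOnto r (f ∘ right) (op (node l′ x t))
    ≡⟨ cong (reverseOnto r (f ∘ right)) (on-node acts (fresh-right root)) ⟩
  reverseOnto r (f ∘ right) (node (op l′) x (op t))
    -- `op` also descends into the finished subtree `l′`, where `w` labels no node.
    ≡⟨ cong (λ s → reverseOnto r (f ∘ right) (node s x (op t)))
            (reverseTree-∉ l (f ∘ left) fresh-left acts) ⟩
  reverseOnto r (f ∘ right) (node l′ x (op t)) ∎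
  where
  open ≡-Reasoning
  l′ = reverseTree l (f ∘ left)
  x  = f (right root)
  fresh-right : ∀ u → f (right u) ≢ w
  fresh-right u eq with () ← fresh (right u) eq
  fresh-left : ∀ u → f (left u) ≢ w
  fresh-left u eq with () ← fresh (left u) eq
reverseOnto-∉ {l = ∅} {r = ∅} f fresh acts t = refl
reverseOnto-∉ {l = l@(node _ _ _)} {r = ∅} f {w} fresh {op} acts t = begin
  op (reverseOnto l (f ∘ left) (node t x ∅))
    ≡⟨ reverseOnto-∉ (f ∘ left) (λ u eq → ⊥-elim (fresh-left u eq)) acts _ ⟩
  reverseOnto l (f ∘ left) (op (node t x ∅))
    ≡⟨ cong (reverseOnto l (f ∘ left)) (on-node acts (fresh-left root)) ⟩
  reverseOnto l (f ∘ left) (node (op t) x (op ∅))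
    ≡⟨ cong (λ s → reverseOnto l (f ∘ left) (node (op t) x s)) (on-leaf acts) ⟩
  reverseOnto l (f ∘ left) (node (op t) x ∅) ∎
  where
  open ≡-Reasoning
  x  = f (left root)
  fresh-left : ∀ u → f (left u) ≢ w
  fresh-left u eq with () ← fresh (left u) eq

reverseTree-∉ ∅ f fresh acts = on-leaf acts
reverseTree-∉ S@(node _ _ _) f {op = op} fresh acts = begin
  op (reverseOnto S f (node ∅ (f root) ∅))
    ≡⟨ reverseOnto-∉ f (λ u eq → ⊥-elim (fresh u eq)) acts _ ⟩
  reverseOnto S f (op (node ∅ (f root) ∅))
    ≡⟨ cong (reverseOnto S f) (on-node acts (fresh root)) ⟩
  reverseOnto S f (node (op ∅) (f root) (op ∅))
    ≡⟨ cong (λ s → reverseOnto S f (node s (f root) s)) (on-leaf acts) ⟩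
  reverseOnto S f (node ∅ (f root) ∅) ∎
  where open ≡-Reasoning

-- Evaluation of `build` along the preorder.

map-preorder : ∀ {l r} (g : Node (node l tt r) → C) →
  map g (preorder (node l tt r)) ≡
  g root ∷ map (g ∘ left) (preorder l) ++ map (g ∘ right) (preorder r)
map-preorder {l = l} {r = r} g = cong (g root ∷_)
  (trans (map-++ g (map left (preorder l)) _)
         (sym (cong₂ _++_ (map-∘ (preorder l)) (map-∘ (preorder r)))))

-- In the induction `S` is a subtree of the fixed tree `B`, and `f` locates its nodes there.
-- Injectivity keeps labels distinct; the second field is needed because `attach` looks up right
-- children in `B`.
record Embedding {S B : BinaryTree} (f : Node S → Node B) : Set where
  field
    injective : Injective _≡_ _≡_ f
    respects-rightChild : ∀ u → rightChild (f u) ≡ Maybe.map f (rightChild u)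

open Embedding

module _ {B : BinaryTree} where

  attachLeft-acts : ∀ v w → ActsAt w (attachLeft {B} v w)
  attachLeft-acts v w .on-leaf = refl
  attachLeft-acts v w .on-node {x = x} x≢w with x ≟ w
  ... | yes x≡w = ⊥-elim (x≢w x≡w)
  ... | no  _   = refl

  attachRight-acts : ∀ v w → ActsAt w (attachRight {B} v w)
  attachRight-acts v w .on-leaf = refl
  attachRight-acts v w .on-node {x = x} x≢w with x ≟ w
  ... | yes x≡w = ⊥-elim (x≢w x≡w)
  ... | no  _   = refl

  attachLeft-here : ∀ v w {l r} →
    attachLeft {B} v w (node l w r) ≡ node (singleton v) w r
  attachLeft-here v w with w ≟ w
  ... | yes _   = refl
  ... | no  w≢w = ⊥-elim (w≢w refl)

  attachRight-here : ∀ v w {l r} →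
    attachRight {B} v w (node l w r) ≡ node l w (singleton v)
  attachRight-here v w with w ≟ w
  ... | yes _   = refl
  ... | no  w≢w = ⊥-elim (w≢w refl)

  embedding-left : ∀ {l r} {f : Node (node l tt r) → Node B} →
    Embedding f → Embedding (f ∘ left)
  embedding-left e .injective eq with refl ← injective e eq = refl
  embedding-left {f = f} e .respects-rightChild u
    rewrite respects-rightChild e (left u) with rightChild u
  ... | just _  = refl
  ... | nothing = refl

  embedding-right : ∀ {l r} {f : Node (node l tt r) → Node B} →
    Embedding f → Embedding (f ∘ right)
  embedding-right e .injective eq with refl ← injective e eq = refl
  embedding-right {f = f} e .respects-rightChild u
    rewrite respects-rightChild e (right u) with rightChild u
  ... | just _  = refl
  ... | nothing = refl

  root-∉ : ∀ {l r} {f : Node (node l tt r) → Node B} → Embedding f →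
    f root ∉ reverseOnto (node l tt r) f
  root-∉ {f = f} e = reverseOnto-∉ f (λ u → injective e)

  -- The context c ends at the free left slot of the first node of ws, or is empty
  -- if ws is.
  AttachesAt : (LabelledTree {B} → LabelledTree {B}) → List (Node B) → Set
  AttachesAt c ws = ∀ v → rightChild v ≡ nothing → build (v ∷ ws) ≡ c (singleton v)

  -- Attachment at `w` passes through `c` and leaves the new node in the left slot of `w`, where the
  -- extended context ends. The equation for `vs` exposes its first node, so that `build (v ∷ vs)`
  -- computes.
  attachesLeft : ∀ {c w ws l r} vs → vs ≡ w ∷ ws → w ∉ c →
    build vs ≡ c (node l w r) → AttachesAt (λ t → c (node t w r)) vs
  attachesLeft {c} {w} {l = l} {r} _ refl w∉c built v noRight
    rewrite noRight | built =
    trans (w∉c (attachLeft-acts v w) _) (cong c (attachLeft-here v w {l} {r}))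

  attachesRight : ∀ {c v u w ws l r} vs → vs ≡ w ∷ ws → rightChild v ≡ just u → u ∉ c →
    build vs ≡ c (node l u r) → build (v ∷ vs) ≡ c (node l u (singleton v))
  attachesRight {c} {v} {u} {l = l} {r} _ refl hasRight u∉c built
    rewrite hasRight | built =
    trans (u∉c (attachRight-acts v u) _) (cong c (attachRight-here v u {l} {r}))

  -- Since `build` works from the end of the list, the tree already built from `ws` is summarised by
  -- the open slot of `c`. The last node of the subtree has no right child and fills this slot. The
  -- right subtree is built first, then the left one; the root is attached last.
  build-preorder : ∀ {l r} {f : Node (node l tt r) → Node B} → Embedding f →
    ∀ {c} ws → AttachesAt c ws → (∀ u → f u ∉ c) →
    build (map f (preorder (node l tt r)) ++ ws) ≡
    c (reverseOnto (node l tt r) f (singleton (f root)))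
  build-root : ∀ l r {f : Node (node l tt r) → Node B} → Embedding f →
    ∀ {c} ws → AttachesAt c ws → (∀ u → f u ∉ c) →
    build (f root ∷ map (f ∘ left) (preorder l) ++ map (f ∘ right) (preorder r) ++ ws)
    ≡ c (reverseOnto (node l tt r) f (singleton (f root)))

  build-preorder {l} {r} {f} e {c} ws attaches fresh = trans
    (cong build (trans
      (cong (_++ ws) (map-preorder f))
      (cong (f root ∷_) (++-assoc (map (f ∘ left) (preorder l)) _ ws))))
    (build-root l r e ws attaches fresh)

  build-root ∅ ∅ e ws attaches fresh = attaches _ (respects-rightChild e root)
  build-root l@(node _ _ _) ∅ {f} e {c} ws attaches fresh =
    attachesLeft {c ∘ reverseOnto l (f ∘ left)} (map (f ∘ left) (preorder l) ++ ws) refl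
      (∉-∘ {c = c} (fresh (left root)) (root-∉ (embedding-left e)))
      (build-preorder (embedding-left e) {c} ws attaches (fresh ∘ left))
      (f root) (respects-rightChild e root)
  build-root l r@(node _ _ _) {f} e {c} ws attaches fresh = byLeft l refl
    where
    eʳ = embedding-right e
    r₁ = f (right root)
    wsʳ = map (f ∘ right) (preorder r) ++ ws
    c′ : LabelledTree {B} → LabelledTree {B}
    c′ = c ∘ reverseOnto r (f ∘ right)
    r₁∉c′ : r₁ ∉ c′
    r₁∉c′ = ∉-∘ {c = c} (fresh (right root)) (root-∉ eʳ)
    built : build wsʳ ≡ c′ (singleton r₁)
    built = build-preorder eʳ {c} ws attaches (fresh ∘ right)
    -- In preorder the left subtree is followed by `r₁`, so its context ends at the left slot of
    -- `r₁`.
    c″ : LabelledTree {B} → LabelledTree {B}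
    c″ t = c′ (node t r₁ ∅)
    fresh″ : ∀ u → f (left u) ∉ c″
    fresh″ u {op} acts t = begin
      op (c′ (node t r₁ ∅))           ≡⟨ fresh (left u) acts _ ⟩
      c (op (reverseOnto r (f ∘ right) (node t r₁ ∅)))
        ≡⟨ cong c (reverseOnto-∉ (f ∘ right) (λ v eq → ⊥-elim (right≢left v eq)) acts _) ⟩
      c′ (op (node t r₁ ∅))           ≡⟨ cong c′ (on-node acts (right≢left root)) ⟩
      c′ (node (op t) r₁ (op ∅))      ≡⟨ cong (λ s → c′ (node (op t) r₁ s)) (on-leaf acts) ⟩
      c″ (op t)                       ∎
      where
      open ≡-Reasoning
      right≢left : ∀ v → f (right v) ≢ f (left u)
      right≢left v eq with () ← injective e eq
    -- The right subtree is built in the same way whatever `l` is. A nonempty `l` must fill the left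
    -- slot of `r₁` before the root becomes the right child of `r₁`.
    byLeft : ∀ l₀ → l ≡ l₀ →
      build (f root ∷ map (f ∘ left) (preorder l) ++ wsʳ)
      ≡ c (reverseOnto (node l tt r) f (singleton (f root)))
    byLeft ∅ refl =
      attachesRight {c′} wsʳ refl (respects-rightChild e root) r₁∉c′ built
    byLeft (node _ _ _) refl =
      attachesRight {c′} (map (f ∘ left) (preorder l) ++ wsʳ) refl
        (respects-rightChild e root) r₁∉c′
        (build-preorder (embedding-left e) {c″} wsʳ
          (attachesLeft {c′} wsʳ refl r₁∉c′ built) fresh″)

ϑ-reverseTree : ∀ B → ϑ B ≡ reverseTree B (const tt)
ϑ-reverseTree ∅ = refl
ϑ-reverseTree B@(node _ _ _) = begin
  mapₙ (const tt) (build (preorder B))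
    ≡⟨ cong (mapₙ (const tt) ∘ build) (trans (++-identityʳ _) (map-id (preorder B))) ⟨
  mapₙ (const tt) (build (map id (preorder B) ++ []))
    -- The whole tree has an empty rest, an empty context and its own nodes as labels.
    ≡⟨ cong (mapₙ (const tt)) (build-preorder identity {id} [] (λ _ _ → refl) (λ _ _ _ → refl)) ⟩
  mapₙ (const tt) (reverseTree B id)
    ≡⟨ mapₙ-reverseTree (const tt) B id ⟩
  reverseTree B (const tt) ∎
  where
  open ≡-Reasoning
  identity : Embedding {B} {B} id
  identity .injective eq = eq
  identity .respects-rightChild u with rightChild u
  ... | just _  = refl
  ... | nothing = refl

-- The unlabelled reversal S ⇒ t and its involutivity.

onto : BinaryTree → BinaryTree → BinaryTree
onto S t = reverseOnto S (const tt) t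

rev : BinaryTree → BinaryTree
rev S = reverseTree S (const tt)

-- As for list reversal with an accumulator, moving a node across and back restores it. Its left
-- subtree is reversed both times, hence the mutual induction with `rev-involutive`.
rev-onto : ∀ l r l′ r′ →
  rev (onto (node l tt r) (node l′ tt r′)) ≡ onto (node l′ tt r′) (node l tt r)
rev-involutive : ∀ S → rev (rev S) ≡ S

rev-onto l (node a _ b) l′ r′ = trans
  (rev-onto a b (rev l) (node l′ tt r′))
  (cong (λ s → onto (node l′ tt r′) (node s tt _)) (rev-involutive l))
rev-onto ∅            ∅ l′ r′ = refl
rev-onto (node a _ b) ∅ l′ r′ = rev-onto a b (node l′ tt r′) ∅

rev-involutive ∅            = refl
rev-involutive (node l _ r) = rev-onto l r ∅ ∅

-- Child flags in preorder and reverse preorder.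

map-reversePreorder : ∀ {l r} (g : Node (node l tt r) → C) →
  map g (reversePreorder (node l tt r)) ≡
  map (g ∘ right) (reversePreorder r) ++ map (g ∘ left) (reversePreorder l) ++ [ g root ]
map-reversePreorder {l = l} {r = r} g = trans
  (map-++ g (map right (reversePreorder r)) _)
  (cong₂ _++_ (sym (map-∘ (reversePreorder r)))
    (trans (map-++ g (map left (reversePreorder l)) _)
           (cong (_++ [ g root ]) (sym (map-∘ (reversePreorder l))))))

isRightChildFlags : BinaryTree → List Bool
isRightChildFlags B = map isRightChild (preorder B)

-- The same flags when B hangs as a right subtree.
isRightChildFlags⁺ : BinaryTree → List Bool
isRightChildFlags⁺ B = map (λ v → isRoot v ∨ isRightChild v) (preorder B)

hasRightChildFlags : BinaryTree → List Bool
hasRightChildFlags B = map hasRightChild (reversePreorder B)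

is-just-map : (f : A → C) (m : Maybe A) → is-just (Maybe.map f m) ≡ is-just m
is-just-map f (just _) = refl
is-just-map f nothing  = refl

hasRightChildFlags-node : ∀ l r →
  hasRightChildFlags (node l tt r) ≡
  hasRightChildFlags r ++ hasRightChildFlags l ++ [ is-just (rootOf r) ]
hasRightChildFlags-node l r = trans (map-reversePreorder hasRightChild)
  (cong₂ _++_ (map-cong (λ v → is-just-map right (rightChild v)) (reversePreorder r))
    (cong₂ (λ fs f → fs ++ [ f ])
      (map-cong (λ v → is-just-map left (rightChild v)) (reversePreorder l))
      (is-just-map right (rootOf r))))

-- Reverse preorder visits `t` first, then the nodes of `l` and `r` in their original preorder. The
-- root of a nonempty `r` gets the nonempty `t` as right child, which yields its flag `true`; if `r`
-- is empty, the root of a nonempty `l` gets no right child.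
hasRightChildFlags-onto : ∀ l r t → is-just (rootOf t) ≡ true →
  hasRightChildFlags (onto (node l tt r) t) ≡
  hasRightChildFlags t ++ isRightChildFlags l ++ isRightChildFlags⁺ r
hasRightChildFlags-rev : ∀ S → hasRightChildFlags (rev S) ≡ isRightChildFlags S

hasRightChildFlags-onto l r@(node a _ b) t t≢∅ = begin
  hasRightChildFlags (onto r (node (rev l) tt t))
    ≡⟨ hasRightChildFlags-onto a b _ refl ⟩
  hasRightChildFlags (node (rev l) tt t) ++ fs
    ≡⟨ cong (_++ fs) (hasRightChildFlags-node (rev l) t) ⟩
  (ht ++ hasRightChildFlags (rev l) ++ [ is-just (rootOf t) ]) ++ fs
    ≡⟨ cong₂ (λ gs g → (ht ++ gs ++ [ g ]) ++ fs) (hasRightChildFlags-rev l) t≢∅ ⟩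
  (ht ++ isRightChildFlags l ++ [ true ]) ++ fs
    ≡⟨ ++-assoc ht _ fs ⟩
  ht ++ (isRightChildFlags l ++ [ true ]) ++ fs
    ≡⟨ cong (ht ++_) (++-assoc (isRightChildFlags l) _ fs) ⟩
  ht ++ isRightChildFlags l ++ true ∷ fs
    ≡⟨ cong (λ gs → ht ++ isRightChildFlags l ++ gs) (map-preorder _) ⟨
  ht ++ isRightChildFlags l ++ isRightChildFlags⁺ r ∎
  where
  open ≡-Reasoning
  ht = hasRightChildFlags t
  fs = isRightChildFlags a ++ isRightChildFlags⁺ b
hasRightChildFlags-onto ∅ ∅ t _ = sym (++-identityʳ _)
hasRightChildFlags-onto l@(node a _ b) ∅ t t≢∅ = begin
  hasRightChildFlags (onto l (node t tt ∅))
    ≡⟨ hasRightChildFlags-onto a b _ refl ⟩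
  hasRightChildFlags (node t tt ∅) ++ fs
    ≡⟨ cong (_++ fs) (hasRightChildFlags-node t ∅) ⟩
  (hasRightChildFlags t ++ [ false ]) ++ fs
    ≡⟨ ++-assoc (hasRightChildFlags t) _ fs ⟩
  hasRightChildFlags t ++ false ∷ fs
    ≡⟨ cong (hasRightChildFlags t ++_) (trans (++-identityʳ _) (map-preorder isRightChild)) ⟨
  hasRightChildFlags t ++ isRightChildFlags l ++ [] ∎
  where
  open ≡-Reasoning
  fs = isRightChildFlags a ++ isRightChildFlags⁺ b

hasRightChildFlags-rev ∅ = refl
hasRightChildFlags-rev (node l _ r) =
  -- The accumulator is a single node; its flag `false` is also that of the root, which is no right
  -- child.
  trans (hasRightChildFlags-onto l r _ refl) (sym (map-preorder isRightChild))

-- Node counts, `spi` and `rspi`.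

length-preorder : ∀ B → length (preorder B) ≡ #nodes B
length-preorder ∅            = refl
length-preorder (node l _ r) = begin
  suc (length (map left (preorder l) ++ map right (preorder r)))
    ≡⟨ cong suc (length-++ (map left (preorder l))) ⟩
  suc (length (map left (preorder l)) + length (map right (preorder r)))
    ≡⟨ cong₂ (λ m n → suc (m + n)) (length-map left (preorder l)) (length-map right (preorder r)) ⟩
  suc (length (preorder l) + length (preorder r))
    ≡⟨ cong₂ (λ m n → suc (m + n)) (length-preorder l) (length-preorder r) ⟩
  suc (#nodes l + #nodes r)
    ≡⟨ +-suc (#nodes l) _ ⟨
  #nodes l + suc (#nodes r) ∎
  where open ≡-Reasoning

reversePreorder-reverse : ∀ B → reversePreorder B ≡ reverse (preorder B)
reversePreorder-reverse ∅            = refl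
reversePreorder-reverse (node l _ r) = sym (begin
  reverse (root ∷ map left (preorder l) ++ map right (preorder r))
    ≡⟨ unfold-reverse root (map left (preorder l) ++ map right (preorder r)) ⟩
  reverse (map left (preorder l) ++ map right (preorder r)) ++ [ root ]
    ≡⟨ cong (_++ [ root ]) (reverse-++ (map left (preorder l)) _) ⟩
  (reverse (map right (preorder r)) ++ reverse (map left (preorder l))) ++ [ root ]
    ≡⟨ ++-assoc (reverse (map right (preorder r))) _ _ ⟩
  reverse (map right (preorder r)) ++ reverse (map left (preorder l)) ++ [ root ]
    ≡⟨ cong₂ (λ us vs → us ++ vs ++ [ root ])
         (reverse-map right (preorder r)) (reverse-map left (preorder l)) ⟨
  map right (reverse (preorder r)) ++ map left (reverse (preorder l)) ++ [ root ]
    ≡⟨ cong₂ (λ us vs → map right us ++ map left vs ++ [ root ])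
         (reversePreorder-reverse r) (reversePreorder-reverse l) ⟨
  map right (reversePreorder r) ++ map left (reversePreorder l) ++ [ root ] ∎)
  where open ≡-Reasoning

length-reversePreorder : ∀ B → length (reversePreorder B) ≡ #nodes B
length-reversePreorder B = begin
  length (reversePreorder B)     ≡⟨ cong length (reversePreorder-reverse B) ⟩
  length (reverse (preorder B))  ≡⟨ length-reverse (preorder B) ⟩
  length (preorder B)            ≡⟨ length-preorder B ⟩
  #nodes B                       ∎
  where open ≡-Reasoning

-- With the length as default, the value depends on the list of flags alone; for a tree this length
-- is the conventional value, the number of nodes.
firstIndex : (A → Bool) → List A → ℕ
firstIndex p xs = maybe toℕ (length xs) (findIndexᵇ p xs)

maybe-toℕ-suc : ∀ {n} (m : Maybe (Fin n)) →
  maybe toℕ (suc n) (Maybe.map Fin.suc m) ≡ suc (maybe toℕ n m)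
maybe-toℕ-suc (just _) = refl
maybe-toℕ-suc nothing  = refl

firstIndex-map : ∀ (p : A → Bool) xs → firstIndex p xs ≡ firstIndex id (map p xs)
firstIndex-map p []       = refl
firstIndex-map p (x ∷ xs) with p x
... | true  = refl
... | false = begin
  maybe toℕ (suc (length xs)) (Maybe.map Fin.suc (findIndexᵇ p xs))
    ≡⟨ maybe-toℕ-suc (findIndexᵇ p xs) ⟩
  suc (firstIndex p xs)
    ≡⟨ cong suc (firstIndex-map p xs) ⟩
  suc (firstIndex id (map p xs))
    ≡⟨ maybe-toℕ-suc (findIndexᵇ id (map p xs)) ⟨
  maybe toℕ (suc (length (map p xs))) (Maybe.map Fin.suc (findIndexᵇ id (map p xs))) ∎
  where open ≡-Reasoning

spi-firstIndex : ∀ B → spi B ≡ firstIndex id (isRightChildFlags B)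
spi-firstIndex B = trans
  (cong (λ n → maybe toℕ n (findIndexᵇ isRightChild (preorder B))) (sym (length-preorder B)))
  (firstIndex-map isRightChild (preorder B))

rspi-firstIndex : ∀ B → rspi B ≡ firstIndex id (hasRightChildFlags B)
rspi-firstIndex B = trans
  (cong (λ n → maybe toℕ n (findIndexᵇ hasRightChild (reversePreorder B)))
        (sym (length-reversePreorder B)))
  (firstIndex-map hasRightChild (reversePreorder B))

rspi-rev : ∀ B → rspi (rev B) ≡ spi B
rspi-rev B = begin
  rspi (rev B)                                ≡⟨ rspi-firstIndex (rev B) ⟩
  firstIndex id (hasRightChildFlags (rev B))  ≡⟨ cong (firstIndex id) (hasRightChildFlags-rev B) ⟩
  firstIndex id (isRightChildFlags B)         ≡⟨ spi-firstIndex B ⟨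
  spi B                                       ∎
  where open ≡-Reasoning

-- The flag lists equated by `hasRightChildFlags-rev` have one entry per node.
#nodes-rev : ∀ B → #nodes (rev B) ≡ #nodes B
#nodes-rev B = begin
  #nodes (rev B)                      ≡⟨ length-reversePreorder (rev B) ⟨
  length (reversePreorder (rev B))    ≡⟨ length-map hasRightChild (reversePreorder (rev B)) ⟨
  length (hasRightChildFlags (rev B)) ≡⟨ cong length (hasRightChildFlags-rev B) ⟩
  length (isRightChildFlags B)        ≡⟨ length-map isRightChild (preorder B) ⟩
  length (preorder B)                 ≡⟨ length-preorder B ⟩
  #nodes B                            ∎
  where open ≡-Reasoning

-- Right chain sequences.

rightDepth : BinaryTree → ℕ
rightDepth B = length (rightBranch B)

rightDepth-node : ∀ l r → rightDepth (node l tt r) ≡ suc (rightDepth r)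
rightDepth-node l r = cong suc (length-map right (rightBranch r))

mapFilter : (A → Bool) → (A → C) → List A → List C
mapFilter p g xs = map g (filterᵇ p xs)

mapFilter-++ : ∀ (p : A → Bool) (g : A → C) xs ys →
  mapFilter p g (xs ++ ys) ≡ mapFilter p g xs ++ mapFilter p g ys
mapFilter-++ p g xs ys =
  trans (cong (map g) (filter-++ (T? ∘ p) xs ys)) (map-++ g (filterᵇ p xs) _)

mapFilter-map : ∀ (p : A → Bool) {g : A → C} (f : D → A) {g′ : D → C} →
  g ∘ f ≗ g′ → ∀ xs → mapFilter p g (map f xs) ≡ mapFilter (p ∘ f) g′ xs
mapFilter-map p f eq []       = refl
mapFilter-map p f eq (x ∷ xs) with p (f x)
... | true  = cong₂ _∷_ (eq x) (mapFilter-map p f eq xs)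
... | false = mapFilter-map p f eq xs

-- Meaningful at the top node of a right chain only.
chainLength : ∀ {B} → Node B → ℕ
chainLength v = length (rightPathFrom v) ∸ 1

-- When `B` hangs as a right subtree, the chain through its root belongs to the parent;
-- `nonRootChains` is what remains.
nonRootChains chains : BinaryTree → List ℕ
nonRootChains B =
  mapFilter (λ v → not (isRoot v ∨ isRightChild v)) chainLength (preorder B)
chains B = mapFilter (not ∘ isRightChild) chainLength (preorder B)

rightChainSequence-chains : ∀ B → rightChainSequence B ≡ chains B
rightChainSequence-chains B = sym (map-∘ (filterᵇ (not ∘ isRightChild) (preorder B)))

mapFilter-subtrees : ∀ {l r} (p : Node (node l tt r) → Bool) →
  mapFilter p chainLength (map left (preorder l) ++ map right (preorder r)) ≡
  mapFilter (p ∘ left) chainLength (preorder l) ++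
  mapFilter (p ∘ right) chainLength (preorder r)
mapFilter-subtrees {l} {r} p = trans
  (mapFilter-++ p chainLength (map left (preorder l)) _)
  (cong₂ _++_
    (mapFilter-map p left (λ v → cong (_∸ 1) (length-map left (rightPathFrom v))) (preorder l))
    (mapFilter-map p right (λ v → cong (_∸ 1) (length-map right (rightPathFrom v))) (preorder r)))

nonRootChains-node : ∀ l r → nonRootChains (node l tt r) ≡ chains l ++ nonRootChains r
nonRootChains-node l r = mapFilter-subtrees _

-- The nodes counted by `rightDepth r` are those below the root on its chain, so their number is the
-- number of edges of that chain.
chains-node : ∀ l r → chains (node l tt r) ≡ rightDepth r ∷ chains l ++ nonRootChains r
chains-node l r =
  cong₂ _∷_ (length-map right (rightBranch r)) (mapFilter-subtrees (not ∘ isRightChild))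

-- The shared root joins the root chain of the first tree, turned upside down, to that of the
-- second, so the lengths add. The other lengths survive in a different order.
chains-onto : ∀ l r l′ r′ → chains (onto (node l tt r) (node l′ tt r′)) ↭
  (rightDepth r + rightDepth r′) ∷
    (chains l ++ nonRootChains r) ++ (chains l′ ++ nonRootChains r′)
chains-rev : ∀ S → chains (rev S) ↭ chains S

chains-onto l r@(node a _ b) l′ r′ = begin
  chains (onto r (node (rev l) tt t))
    ↭⟨ chains-onto a b (rev l) t ⟩
  (rightDepth b + rightDepth t) ∷
    (chains a ++ nonRootChains b) ++ (chains (rev l) ++ nonRootChains t)
    ≡⟨ cong₂ _∷_ depth (cong₂ (λ xs ys → xs ++ (chains (rev l) ++ ys))
         (sym (nonRootChains-node a b)) (nonRootChains-node l′ r′)) ⟩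
  d ∷ nonRootChains r ++ (chains (rev l) ++ cs′)
    ↭⟨ prep d (++⁺ˡ (nonRootChains r) (++⁺ʳ cs′ (chains-rev l))) ⟩
  d ∷ nonRootChains r ++ (chains l ++ cs′)
    ↭⟨ prep d (shifts (nonRootChains r) (chains l)) ⟩
  d ∷ chains l ++ nonRootChains r ++ cs′
    ≡⟨ cong (d ∷_) (++-assoc (chains l) _ cs′) ⟨
  d ∷ (chains l ++ nonRootChains r) ++ cs′ ∎
  where
  open PermutationReasoning
  t   = node l′ tt r′
  d   = rightDepth r + rightDepth r′
  cs′ = chains l′ ++ nonRootChains r′
  -- One edge has moved from the root chain of the first tree to that of the accumulator.
  depth : rightDepth b + rightDepth t ≡ d
  depth = trans (cong (rightDepth b +_) (rightDepth-node l′ r′))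
    (trans (+-suc (rightDepth b) _) (cong (_+ rightDepth r′) (sym (rightDepth-node a b))))
chains-onto ∅ ∅ l′ r′ = ↭-reflexive (chains-node l′ r′)
chains-onto l@(node a _ b) ∅ l′ r′ = begin
  chains (onto l (node t tt ∅))
    -- Now `t` is a left subtree, so its root chain is complete; the chain of the root of `l` is the
    -- one still growing.
    ↭⟨ chains-onto a b t ∅ ⟩
  (rightDepth b + 0) ∷ cs ++ (chains t ++ [])
    ≡⟨ cong₂ _∷_ (+-identityʳ _) (cong (cs ++_) (++-identityʳ _)) ⟩
  rightDepth b ∷ cs ++ chains t
    ≡⟨ cong₂ _++_ (sym (chains-node a b)) (chains-node l′ r′) ⟩
  chains l ++ rightDepth r′ ∷ cs′
    ↭⟨ shift (rightDepth r′) (chains l) cs′ ⟩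
  rightDepth r′ ∷ chains l ++ cs′
    ≡⟨ cong (λ xs → rightDepth r′ ∷ xs ++ cs′) (++-identityʳ (chains l)) ⟨
  rightDepth r′ ∷ (chains l ++ []) ++ cs′ ∎
  where
  open PermutationReasoning
  t   = node l′ tt r′
  cs  = chains a ++ nonRootChains b
  cs′ = chains l′ ++ nonRootChains r′

chains-rev ∅ = ↭-reflexive refl
chains-rev (node l _ r) = begin
  chains (rev (node l tt r))
    ↭⟨ chains-onto l r ∅ ∅ ⟩
  (rightDepth r + 0) ∷ (chains l ++ nonRootChains r) ++ []
    ≡⟨ cong₂ _∷_ (+-identityʳ _) (++-identityʳ _) ⟩
  rightDepth r ∷ chains l ++ nonRootChains r
    ≡⟨ chains-node l r ⟨
  chains (node l tt r) ∎
  where open PermutationReasoning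

theorem3p1 : (n : ℕ) → 1 ≤ n → (B : BinaryTree) → #nodes B ≡ n →
    #nodes (ϑ B) ≡ n
    × ϑ (ϑ B) ≡ B
    × rightChainSequence (ϑ B) ↭ rightChainSequence B
    × spi (ϑ B) ≡ rspi B
    × rspi (ϑ B) ≡ spi B
theorem3p1 n _ B #B≡n
  rewrite ϑ-reverseTree B
        | ϑ-reverseTree (rev B)
        | rightChainSequence-chains (rev B)
        | rightChainSequence-chains B =
    trans (#nodes-rev B) #B≡n
  , rev-involutive B
  , chains-rev B
  , trans (sym (rspi-rev (rev B))) (cong rspi (rev-involutive B))
  , rspi-rev B
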